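{- A strong semicomplete composition $Q=T[H_1,\dots,H_t]$ contains a strong spanning semicomplete composition without a 2-cycle (i.e., a spanning subdigraph which is a strong semicomplete composition and has no 2-cycle) if and only if $t\ge 3$.
   Context: Digraphs are finite, without loops or parallel arcs (2-cycles are allowed). A digraph is semicomplete if there is at least one arc between every pair of distinct vertices. Let $T$ be a digraph with vertices $u_1,\dots,u_t$ ($t\ge 2$) and let $H_1,\dots,H_t$ be pairwise disjoint nonempty digraphs. The composition $Q=T[H_1,\dots,H_t]$ is the digraph with vertex set $\bigcup_i V(H_i)$ and arc set $\bigcup_{i=1}^t A(H_i)\cup\{xy : x\in V(H_i),\ y\in V(H_p),\ u_iu_p\in A(T)\}$. It is a semicomplete composition if $T$ is semicomplete. A digraph is strong if for every ordered pair of vertices $(x,y)$ there is a directed path from $x$ to $y$. A 2-cycle is a pair of opposite arcs $xy,yx$.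
   Formalization: The contained spanning semicomplete composition is required to have the same number t of parts as Q; with any number of parts allowed, "only if" fails: for t = 2 the complete digraph on 3 vertices contains the directed 3-cycle C_3[K_1,K_1,K_1]. -}

module Defs where

open import Level using (0ℓ)
open import Data.Nat using (ℕ; zero; suc; _+_; _≤_)
open import Data.Fin using (Fin; zero; suc; _≟_)
open import Data.Fin.Properties using (+↔⊎)
open import Data.List using (List; []; _∷_)
open import Data.List.Relation.Unary.Unique.Propositional using (Unique)
open import Data.Product using (Σ; Σ-syntax; ∃-syntax; _×_; _,_)
open import Data.Sum using (_⊎_; inj₁; inj₂)
open import Data.Sum.Function.Propositional using (_⊎-↔_)
open import Function using (_∘_)
open import Function.Bundles using (_↔_; _⇔_; mk↔ₛ′; Inverse)
open import Function.Properties.Inverse using (↔-trans; ↔-sym)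
open import Relation.Binary using (Rel; Decidable)
open import Relation.Binary.Construct.Closure.ReflexiveTransitive using (Star; ε; _◅_)
open import Relation.Binary.PropositionalEquality using (_≢_; refl)
open import Relation.Nullary using (¬_; yes; no)

-- Arcs form a relation on V, hence carry no multiplicity; opposite arcs are
-- allowed.
record Digraph (V : Set) : Set₁ where
  field
    order    : ℕ
    finite   : V ↔ Fin order
    Arc      : Rel V 0ℓ
    arc?     : Decidable Arc
    loopless : ∀ x → ¬ Arc x x

open Digraph public

module _ {V : Set} (D : Digraph V) where

  Semicomplete : Set
  Semicomplete = ∀ x y → x ≢ y → Arc D x y ⊎ Arc D y x

  Walk : V → V → Set
  Walk = Star (Arc D)

  vertices : ∀ {x y} → Walk x y → List V
  vertices {x} ε       = x ∷ []
  vertices {x} (_ ◅ w) = x ∷ vertices w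

  Path : V → V → Set
  Path x y = Σ[ w ∈ Walk x y ] Unique (vertices w)

  Strong : Set
  Strong = ∀ x y → Path x y

  Has2Cycle : Set
  Has2Cycle = ∃[ x ] ∃[ y ] (Arc D x y × Arc D y x)

-- Spanning is built in: both digraphs have the vertex set V.
_IsSpanningSubdigraphOf_ : {V : Set} → Digraph V → Digraph V → Set
R IsSpanningSubdigraphOf D = ∀ {x y} → Arc R x y → Arc D x y

record _≅_ {V W : Set} (D : Digraph V) (E : Digraph W) : Set where
  field
    bijection : V ↔ W
    arcs      : ∀ x y → Arc D x y ⇔ Arc E (Inverse.to bijection x) (Inverse.to bijection y)

module _ {t : ℕ} (T : Digraph (Fin t)) {W : Fin t → Set} (H : ∀ i → Digraph (W i)) where

  data CompositionArc : Rel (Σ (Fin t) W) 0ℓ where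
    inner : ∀ {i x y} → Arc (H i) x y → CompositionArc (i , x) (i , y)
    outer : ∀ {i p x y} → Arc T i p → CompositionArc (i , x) (p , y)

  compositionArc? : Decidable CompositionArc
  compositionArc? (i , x) (p , y) with arc? T i p
  ... | yes a = yes (outer a)
  ... | no ¬a with i ≟ p
  ...   | no i≢p = no λ { (inner _) → i≢p refl ; (outer a) → ¬a a }
  ...   | yes refl with arc? (H i) x y
  ...     | yes b = yes (inner b)
  ...     | no ¬b = no λ { (inner b) → ¬b b ; (outer a) → ¬a a }

sumOrders : ∀ {t} → (Fin t → ℕ) → ℕ
sumOrders {zero}  n = 0
sumOrders {suc t} n = n zero + sumOrders (n ∘ suc)

Σ-finite : ∀ {t} {W : Fin t → Set} (n : Fin t → ℕ) →
           (∀ i → W i ↔ Fin (n i)) → Σ (Fin t) W ↔ Fin (sumOrders n)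
Σ-finite {zero}      n f = mk↔ₛ′ (λ ()) (λ ()) (λ ()) (λ ())
Σ-finite {suc t} {W} n f =
  ↔-trans split (↔-trans (f zero ⊎-↔ Σ-finite (n ∘ suc) (f ∘ suc)) (↔-sym +↔⊎))
  where
  split : Σ (Fin (suc t)) W ↔ (W zero ⊎ Σ (Fin t) (W ∘ suc))
  split = mk↔ₛ′
    (λ { (zero , x) → inj₁ x ; (suc i , x) → inj₂ (i , x) })
    (λ { (inj₁ x) → zero , x ; (inj₂ (i , x)) → suc i , x })
    (λ { (inj₁ x) → refl ; (inj₂ (i , x)) → refl })
    (λ { (zero , x) → refl ; (suc i , x) → refl })

-- T[H₁,…,Hₜ]; the union of the pairwise disjoint vertex sets is the Σ-type.
_[_] : ∀ {t} (T : Digraph (Fin t)) {W : Fin t → Set} →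
       (∀ i → Digraph (W i)) → Digraph (Σ (Fin t) W)
T [ H ] = record
  { order    = sumOrders (order ∘ H)
  ; finite   = Σ-finite (order ∘ H) (finite ∘ H)
  ; Arc      = CompositionArc T H
  ; arc?     = compositionArc? T H
  ; loopless = λ { (i , x) (inner a) → loopless (H i) x a
                 ; (i , x) (outer a) → loopless T i a }
  }

-- D is, up to isomorphism, T[H₁,…,Hₜ] with T semicomplete on t ≥ 2 vertices and
-- all Hᵢ nonempty.  The number t of parts is an index because one digraph can be a
-- semicomplete composition for several t: the complete digraph on three
-- vertices is one for t = 2 and for t = 3.
record IsSemicompleteComposition (t : ℕ) {V : Set} (D : Digraph V) : Set₁ where
  field
    t≥2          : 2 ≤ t
    T            : Digraph (Fin t)
    semicomplete : Semicomplete T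
    W            : Fin t → Set
    H            : ∀ i → Digraph (W i)
    nonempty     : ∀ i → W i
    iso          : D ≅ (T [ H ])

{-# OPTIONS --safe #-}

-- If t = 2, a strong composition needs both arcs between the two parts, hence
-- has a 2-cycle.  If t ≥ 3, the quotient T is strong, and in a strong
-- semicomplete digraph on at least three vertices every 2-cycle xyx has an arc
-- whose deletion preserves strongness: a third vertex z is reached from {x,y}
-- and reaches {x,y} without either arc, and together with an arc between z and
-- the missing one of x, y this gives a detour for xy or for yx.  Deleting such
-- arcs leaves a strong spanning tournament T′ of T, and T′ composed with the
-- arcless digraphs on the V(Hᵢ) is the required subdigraph.
module Submission where

open import Defs
open import Data.Empty using (⊥)
open import Data.Nat using (ℕ; zero; suc; _≤_; z≤n; s≤s)
open import Data.Fin using (Fin; zero; suc)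
open import Data.Fin.Properties using (inj⇒≟)
open import Data.List using (List; []; _∷_; allFin; cartesianProduct)
open import Data.List.Membership.Propositional using (_∈_)
open import Data.List.Membership.Propositional.Properties using (∈-allFin; ∈-cartesianProduct⁺)
import Data.List.Membership.DecPropositional as DecMembership
open import Data.List.Relation.Unary.All using (All; []; _∷_; lookup)
import Data.List.Relation.Unary.All as All
open import Data.List.Relation.Unary.All.Properties using (¬Any⇒All¬)
open import Data.List.Relation.Unary.AllPairs using ([]; _∷_)
open import Data.List.Relation.Unary.Any using (here; there)
open import Data.Product using (Σ; Σ-syntax; ∃-syntax; _×_; _,_; proj₁; proj₂)
open import Data.Sum using (_⊎_; inj₁; inj₂)
import Data.Sum as Sum
open import Function using (id; _∘_)
open import Function.Bundles using (_⇔_; mk⇔; Inverse; Equivalence)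
open import Function.Construct.Identity using (↔-id; ⇔-id)
open import Function.Properties.Inverse using (↔⇒↣)
open import Relation.Binary using (Rel; DecidableEquality)
open import Relation.Binary.Construct.Closure.ReflexiveTransitive using (Star; ε; _◅_; _◅◅_; gmap; kleisliStar)
import Relation.Binary.Construct.Closure.ReflexiveTransitive as Star
open import Relation.Binary.PropositionalEquality using (_≡_; _≢_; refl; sym; subst₂)
open import Relation.Nullary using (¬_; yes; no; contradiction)
open import Relation.Nullary.Decidable using (_×-dec_; ¬?)
open import Level using (0ℓ)

-- Walks, paths and the deletion of an arc

Connected : {V : Set} → Digraph V → Set
Connected D = ∀ x y → Walk D x y

module _ {V : Set} (D : Digraph V) where

  vertex≟ : DecidableEquality V
  vertex≟ = inj⇒≟ (↔⇒↣ (finite D))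

  open DecMembership vertex≟ using (_∈?_)

  dropUntil : ∀ {x y z} (p : Path D y z) → x ∈ vertices D (proj₁ p) → Path D x z
  dropUntil (ε     , u)     (here refl)  = ε , u
  dropUntil (a ◅ w , u)     (here refl)  = a ◅ w , u
  dropUntil (_ ◅ w , _ ∷ u) (there x∈w) = dropUntil (w , u) x∈w

  walk⇒path : ∀ {x y} → Walk D x y → Path D x y
  walk⇒path ε = ε , [] ∷ []
  walk⇒path {x} (a ◅ w) with walk⇒path w
  ... | p , u with x ∈? vertices D p
  ...   | yes x∈p = dropUntil (p , u) x∈p
  ...   | no  x∉p = a ◅ p , ¬Any⇒All¬ _ x∉p ∷ u

  connected⇒strong : Connected D → Strong D
  connected⇒strong c x y = walk⇒path (c x y)

  removeArc : V → V → Digraph V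
  removeArc x y = record
    { order    = order D
    ; finite   = finite D
    ; Arc      = λ u v → Arc D u v × ¬ (u ≡ x × v ≡ y)
    ; arc?     = λ u v → arc? D u v ×-dec ¬? (vertex≟ u x ×-dec vertex≟ v y)
    ; loopless = λ u a → loopless D u (proj₁ a)
    }

  removeArc-semicomplete : ∀ {x y} → Arc D y x → Semicomplete D → Semicomplete (removeArc x y)
  removeArc-semicomplete {x} {y} yx sc u v u≢v
    with vertex≟ u x ×-dec vertex≟ v y | vertex≟ v x ×-dec vertex≟ u y
  -- The opposite arc survives: it could coincide with the deleted one only if its ends were equal.
  ... | yes (refl , refl) | _ = inj₂ (yx , λ { (refl , _) → u≢v refl })
  ... | no _ | yes (refl , refl) = inj₁ (yx , λ { (refl , _) → u≢v refl })
  ... | no ¬uv | no ¬vu = Sum.map (_, ¬uv) (_, ¬vu) (sc u v u≢v)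

  -- Every use of the deleted arc is replaced by the detour.
  removeArc-connected : ∀ {x y} → Walk (removeArc x y) x y → Connected D → Connected (removeArc x y)
  removeArc-connected {x} {y} detour c u v = kleisliStar id bypass (c u v)
    where
    bypass : ∀ {u v} → Arc D u v → Walk (removeArc x y) u v
    bypass {u} {v} a with vertex≟ u x ×-dec vertex≟ v y
    ... | yes (refl , refl) = detour
    ... | no  ¬xy           = (a , ¬xy) ◅ ε

  -- Detours around a 2-cycle

  module _ (x y : V) where

    -- Both arcs are avoided at once, since which of them may be deleted is known only after a
    -- detour is found.
    ArcOff : Rel V 0ℓ
    ArcOff u v = Arc D u v × ¬ (u ≡ x × v ≡ y) × ¬ (u ≡ y × v ≡ x)

    arcOff? : ∀ {u v} → Arc D u v → ArcOff u v ⊎ (u ≡ x × v ≡ y) ⊎ (u ≡ y × v ≡ x)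
    arcOff? {u} {v} a with vertex≟ u x ×-dec vertex≟ v y | vertex≟ u y ×-dec vertex≟ v x
    ... | yes xy | _      = inj₂ (inj₁ xy)
    ... | no _   | yes yx = inj₂ (inj₂ yx)
    ... | no ¬xy | no ¬yx = inj₁ (a , ¬xy , ¬yx)

    -- The walk is cut just before its first arc between `x` and `y`, so the prefix ends at one of
    -- them.
    entry : ∀ {u v} → Walk D u v → Star ArcOff u v ⊎ Star ArcOff u x ⊎ Star ArcOff u y
    entry ε = inj₁ ε
    entry (a ◅ w) with arcOff? a
    ... | inj₁ b                    = Sum.map (b ◅_) (Sum.map (b ◅_) (b ◅_)) (entry w)
    ... | inj₂ (inj₁ (refl , refl)) = inj₂ (inj₁ ε)
    ... | inj₂ (inj₂ (refl , refl)) = inj₂ (inj₂ ε)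

    -- Dually, the walk is cut after its last such arc; recursing into the tail first lets later
    -- uses take precedence.
    exit : ∀ {u v} → Walk D u v → Star ArcOff u v ⊎ Star ArcOff x v ⊎ Star ArcOff y v
    exit ε = inj₁ ε
    exit (a ◅ w) with exit w
    ... | inj₂ p = inj₂ p
    ... | inj₁ p with arcOff? a
    ...   | inj₁ b                    = inj₁ (b ◅ p)
    ...   | inj₂ (inj₁ (refl , refl)) = inj₂ (inj₂ p)
    ...   | inj₂ (inj₂ (refl , refl)) = inj₂ (inj₁ p)

    detour : Semicomplete D → Connected D → ∀ {z} → z ≢ x → z ≢ y →
             Star ArcOff x y ⊎ Star ArcOff y x
    -- An uncut walk already starts or ends at `x`, so that alternative merges with the one for `x`.
    detour sc c {z} z≢x z≢y with Sum.fromInj₂ inj₁ (exit (c x z)) | Sum.fromInj₂ inj₁ (entry (c z x))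
    ... | inj₁ xz | inj₂ zy = inj₁ (xz ◅◅ zy)
    ... | inj₂ yz | inj₁ zx = inj₂ (yz ◅◅ zx)
    -- Both pieces meet the 2-cycle at `x`, so `y` is attached through its arc with `z`, whose
    -- direction decides which of the two arcs is bypassed.
    ... | inj₁ xz | inj₁ zx with sc z y z≢y
    ...   | inj₁ zy = inj₁ (xz ◅◅ (zy , z≢x ∘ proj₁ , z≢y ∘ proj₁) ◅ ε)
    ...   | inj₂ yz = inj₂ ((yz , z≢y ∘ proj₂ , z≢x ∘ proj₂) ◅ zx)
    detour sc c {z} z≢x z≢y | inj₂ yz | inj₂ zy with sc z x z≢x
    ...   | inj₁ zx = inj₂ (yz ◅◅ (zx , z≢x ∘ proj₁ , z≢y ∘ proj₁) ◅ ε)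
    ...   | inj₂ xz = inj₁ ((xz , z≢y ∘ proj₂ , z≢x ∘ proj₂) ◅ zy)

thirdVertex : ∀ {n} (x y : Fin (suc (suc (suc n)))) → ∃[ z ] (z ≢ x × z ≢ y)
thirdVertex zero          zero          = suc zero , (λ ()) , (λ ())
thirdVertex zero          (suc zero)    = suc (suc zero) , (λ ()) , (λ ())
thirdVertex zero          (suc (suc _)) = suc zero , (λ ()) , (λ ())
thirdVertex (suc zero)    zero          = suc (suc zero) , (λ ()) , (λ ())
thirdVertex (suc (suc _)) zero          = suc zero , (λ ()) , (λ ())
thirdVertex (suc _)       (suc _)       = zero , (λ ()) , (λ ())

-- Strong spanning tournaments

No2CycleAt : {V : Set} → Digraph V → V × V → Set
No2CycleAt D (x , y) = ¬ (Arc D x y × Arc D y x)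

module _ {n : ℕ} (T : Digraph (Fin (suc (suc (suc n))))) (sc : Semicomplete T) (c : Connected T) where

  -- Induction on the list works because deleting arcs creates no 2-cycle: pairs already treated
  -- stay settled.
  destroy2Cycles : (ps : List (Fin (suc (suc (suc n))) × Fin (suc (suc (suc n))))) →
    Σ[ T′ ∈ Digraph (Fin (suc (suc (suc n)))) ]
      (T′ IsSpanningSubdigraphOf T × Semicomplete T′ × Connected T′ × All (No2CycleAt T′) ps)
  destroy2Cycles [] = T , id , sc , c , []
  destroy2Cycles ((x , y) ∷ ps) with destroy2Cycles ps
  ... | T′ , sub , sc′ , c′ , none with arc? T′ x y ×-dec arc? T′ y x
  ...   | no ¬xyx = T′ , sub , sc′ , c′ , ¬xyx ∷ none
  ...   | yes (xy , yx) with thirdVertex x y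
  ...     | z , z≢x , z≢y with detour T′ x y sc′ c′ z≢x z≢y
  ...       | inj₁ w =
    removeArc T′ x y , sub ∘ proj₁ , removeArc-semicomplete T′ yx sc′ ,
    removeArc-connected T′ (Star.map (λ { (a , ¬xy , _) → a , ¬xy }) w) c′ ,
    (λ { ((_ , ¬xy) , _) → ¬xy (refl , refl) }) ∷
    All.map (λ { no2 ((a , _) , (b , _)) → no2 (a , b) }) none
  ...       | inj₂ w =
    removeArc T′ y x , sub ∘ proj₁ , removeArc-semicomplete T′ xy sc′ ,
    removeArc-connected T′ (Star.map (λ { (a , _ , ¬yx) → a , ¬yx }) w) c′ ,
    (λ { (_ , (_ , ¬yx)) → ¬yx (refl , refl) }) ∷
    All.map (λ { no2 ((a , _) , (b , _)) → no2 (a , b) }) none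

  strongSpanningTournament :
    Σ[ T′ ∈ Digraph (Fin (suc (suc (suc n)))) ]
      (T′ IsSpanningSubdigraphOf T × Semicomplete T′ × Connected T′ × ¬ Has2Cycle T′)
  strongSpanningTournament
    with destroy2Cycles (cartesianProduct (allFin _) (allFin _))
  ... | T′ , sub , sc′ , c′ , none =
    T′ , sub , sc′ , c′ ,
    λ { (x , y , xyx) → lookup none (∈-cartesianProduct⁺ (∈-allFin x) (∈-allFin y)) xyx }

-- Compositions and their quotients

arcless : {V : Set} → Digraph V → Digraph V
arcless D = record
  { order    = order D
  ; finite   = finite D
  ; Arc      = λ _ _ → ⊥
  ; arc?     = λ _ _ → no id
  ; loopless = λ _ → id
  }

≅-refl : {V : Set} {D : Digraph V} → D ≅ D
≅-refl = record { bijection = ↔-id _ ; arcs = λ _ _ → ⇔-id _ }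

module _ {t : ℕ} (T : Digraph (Fin t)) {W : Fin t → Set} (H : ∀ i → Digraph (W i)) where

  projectWalk : ∀ {u v} → Walk (T [ H ]) u v → Walk T (proj₁ u) (proj₁ v)
  projectWalk = kleisliStar proj₁ λ { (inner _) → ε ; (outer a) → a ◅ ε }

  quotient-connected : (∀ i → W i) → Strong (T [ H ]) → Connected T
  quotient-connected nonempty strong i j =
    projectWalk (proj₁ (strong (i , nonempty i) (j , nonempty j)))

  -- An outer arc may end anywhere in its target part, so the last one hits `y` and the earlier ones
  -- stop at representatives. The leading arc `a` keeps the lifted walk from being empty.
  liftWalk : (∀ i → W i) → ∀ {i j k x y} → Arc T i j → Walk T j k → Walk (T [ H ]) (i , x) (k , y)
  liftWalk nonempty a ε                  = outer a ◅ ε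
  liftWalk nonempty a (_◅_ {i = j} b w) = outer {y = nonempty j} a ◅ liftWalk nonempty b w

outNeighbour : ∀ {n} (T : Digraph (Fin (suc (suc n)))) → Connected T → ∀ i → ∃[ j ] Arc T i j
outNeighbour T c zero    with c zero (suc zero)
... | a ◅ _ = _ , a
outNeighbour T c (suc i) with c (suc i) zero
... | a ◅ _ = _ , a

-- Leaving part `i` first, even when `k` is `i`, connects vertices of one part without using arcs
-- inside it.
composition-connected : ∀ {n} (T : Digraph (Fin (suc (suc n)))) {W : Fin (suc (suc n)) → Set}
  (H : ∀ i → Digraph (W i)) → (∀ i → W i) → Connected T → Connected (T [ H ])
composition-connected T H nonempty c (i , x) (k , y) with outNeighbour T c i
... | j , a = liftWalk T H nonempty a (c j k)

-- Two parts force a 2-cycle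

arc₀₁ : (T : Digraph (Fin 2)) → Walk T zero (suc zero) → Arc T zero (suc zero)
-- A first arc that does not cross to the other vertex would be a loop.
arc₀₁ T (_◅_ {j = zero}     a _) = contradiction a (loopless T zero)
arc₀₁ T (_◅_ {j = suc zero} a _) = a

arc₁₀ : (T : Digraph (Fin 2)) → Walk T (suc zero) zero → Arc T (suc zero) zero
arc₁₀ T (_◅_ {j = zero}     a _) = a
arc₁₀ T (_◅_ {j = suc zero} a _) = contradiction a (loopless T (suc zero))

-- `R` may decompose differently from the original digraph, so the 2-cycle is found in the quotient
-- of `R` itself and pulled back along the isomorphism to representatives of the two parts.
twoParts-has2Cycle : {V : Set} {R : Digraph V} → IsSemicompleteComposition 2 R → Strong R → Has2Cycle R
twoParts-has2Cycle {R = R} isC strong =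
  from v₀ , from v₁ , arc (arc₀₁ T (walk v₀ v₁)) , arc (arc₁₀ T (walk v₁ v₀))
  where
  open IsSemicompleteComposition isC
  open _≅_ iso
  open Inverse bijection using (to; from; strictlyInverseˡ)

  v₀ v₁ : Σ (Fin 2) W
  v₀ = zero , nonempty zero
  v₁ = suc zero , nonempty (suc zero)

  walk : ∀ u v → Walk T (proj₁ u) (proj₁ v)
  walk u v = projectWalk T H (subst₂ (Walk (T [ H ])) (strictlyInverseˡ u) (strictlyInverseˡ v)
    (gmap to (λ {x} {y} → Equivalence.to (arcs x y)) (proj₁ (strong (from u) (from v)))))

  arc : ∀ {u v} → Arc T (proj₁ u) (proj₁ v) → Arc R (from u) (from v)
  arc {u} {v} a = Equivalence.from (arcs (from u) (from v))
    (subst₂ (CompositionArc T H) (sym (strictlyInverseˡ u)) (sym (strictlyInverseˡ v)) (outer a))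

theorem5p3 : ∀ {t : ℕ} (T : Digraph (Fin t)) {W : Fin t → Set} (H : ∀ i → Digraph (W i)) →
    2 ≤ t → (∀ i → W i) → Semicomplete T → Strong (T [ H ]) →
    (Σ[ R ∈ Digraph (Σ (Fin t) W) ]
    (R IsSpanningSubdigraphOf (T [ H ])
    × IsSemicompleteComposition t R
    × Strong R
    × ¬ Has2Cycle R))
    ⇔ (3 ≤ t)
theorem5p3 {suc (suc zero)} T H (s≤s (s≤s z≤n)) nonempty sc strong = mk⇔
  (λ { (_ , _ , isC , strongR , no2) → contradiction (twoParts-has2Cycle isC strongR) no2 })
  λ { (s≤s (s≤s ())) }
theorem5p3 {suc (suc (suc n))} T {W} H 2≤t nonempty sc strong = mk⇔
  (λ _ → s≤s (s≤s (s≤s z≤n)))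
  (λ _ → R , (λ { (inner ()) ; (outer a) → outer (sub a) }) , isC , strongR , no2)
  where
  tournament = strongSpanningTournament T sc (quotient-connected T H nonempty strong)
  T′  = proj₁ tournament
  sub : T′ IsSpanningSubdigraphOf T
  sub = proj₁ (proj₂ tournament)
  sc′ = proj₁ (proj₂ (proj₂ tournament))
  c′  = proj₁ (proj₂ (proj₂ (proj₂ tournament)))
  no2Cycle′ = proj₂ (proj₂ (proj₂ (proj₂ tournament)))

  R : Digraph (Σ (Fin (suc (suc (suc n)))) W)
  -- Emptying the parts removes any 2-cycles inside them; connectivity comes from `T′` alone.
  R = T′ [ arcless ∘ H ]

  isC : IsSemicompleteComposition (suc (suc (suc n))) R
  isC = record
    { t≥2 = 2≤t ; T = T′ ; semicomplete = sc′ ; W = W ; H = arcless ∘ H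
    ; nonempty = nonempty ; iso = ≅-refl }

  strongR : Strong R
  strongR = connected⇒strong R (composition-connected T′ (arcless ∘ H) nonempty c′)

  no2 : ¬ Has2Cycle R
  no2 (_ , _ , inner () , _)
  no2 (_ , _ , outer _ , inner ())
  no2 (_ , _ , outer a , outer b) = no2Cycle′ (_ , _ , a , b)
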